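{- Let $E=\{a,b,c,d,e,f,g,h\}$ and let $M$ be the matroid of rank $3$ on $E$ whose bases are exactly the $3$-element subsets $B\subseteq E$ satisfying $|B\cap F|\le 2$ for every $$F\in\{\{a,f,d\},\{e,b,h\},\{a,b,g\},\{e,f,c\},\{e,g,d\},\{a,c,h\},\{b,c,d\},\{f,g,h\}\}.$$ Then there is no connected matroid $M'$ on $E$ whose family of bases $\mathcal{B}(M')$ satisfies $\mathcal{B}(M')\subsetneq\mathcal{B}(M)$.
   Context: $\mathcal{B}(M)$ denotes the family of bases of a matroid $M$. (The eight listed sets pairwise meet in at most one element, so the described family is indeed the base family of a simple connected rank-$3$ matroid.) -}

module Defs where

open import Data.Nat using (ℕ; _≤_)
open import Data.Fin using (Fin; #_)
open import Data.Fin.Subset using (Subset; ⁅_⁆; _∈_; _∉_; _⊆_; _⊂_; _∪_; _∩_; _-_; ∣_∣)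
open import Data.Bool using (Bool; T)
open import Data.Product using (Σ; _×_; ∃; ∃-syntax)
open import Data.List using (List; _∷_; [])
open import Data.List.Relation.Unary.All using (All)
open import Relation.Binary.PropositionalEquality using (_≡_; _≢_)
open import Relation.Nullary using (¬_)

Family : ℕ → Set
Family n = Subset n → Bool

record IsMatroid {n : ℕ} (ℬ : Family n) : Set where
  field
    base-nonempty : ∃[ B ] T (ℬ B)
    base-exchange : ∀ B₁ B₂ → T (ℬ B₁) → T (ℬ B₂) →
                    ∀ x → x ∈ B₁ → x ∉ B₂ →
                    ∃[ y ] (y ∈ B₂ × y ∉ B₁ × T (ℬ ((B₁ - x) ∪ ⁅ y ⁆)))

Independent : ∀ {n} → Family n → Subset n → Set
Independent ℬ X = ∃[ B ] (T (ℬ B) × X ⊆ B)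

Circuit : ∀ {n} → Family n → Subset n → Set
Circuit ℬ C = ¬ Independent ℬ C × (∀ Y → Y ⊂ C → Independent ℬ Y)

Connected : ∀ {n} → Family n → Set
Connected {n} ℬ = ∀ (x y : Fin n) → x ≢ y → ∃[ C ] (Circuit ℬ C × x ∈ C × y ∈ C)

a b c d e f g h : Fin 8
a = # 0
b = # 1
c = # 2
d = # 3
e = # 4
f = # 5
g = # 6
h = # 7

triple : Fin 8 → Fin 8 → Fin 8 → Subset 8
triple x y z = ⁅ x ⁆ ∪ (⁅ y ⁆ ∪ ⁅ z ⁆)

lines : List (Subset 8)
lines = triple a f d ∷ triple e b h ∷ triple a b g ∷ triple e f c
      ∷ triple e g d ∷ triple a c h ∷ triple b c d ∷ triple f g h ∷ []

IsBaseM : Subset 8 → Set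
IsBaseM B = ∣ B ∣ ≡ 3 × All (λ F → ∣ B ∩ F ∣ ≤ 2) lines

{-# OPTIONS --safe #-}
module Submission where

-- Suppose M′ is a connected matroid all of whose bases are bases of M, with some base of M missing.
-- Keep a list of candidates for the bases of M′, initially the bases of M, and for each pair of
-- elements in turn distinguish whether it is independent or parallel in M′.  Basis exchange then
-- removes candidates: every base meets the set of elements extending a given independent pair to a
-- base, and parallel elements are interchangeable in bases.  In every branch with a parallel pair,
-- and, when M′ is simple, after removing any single base of M, these rules lead to a set S which
-- all remaining candidates meet in exactly one element.  Then r(S) + r(E ∖ S) = 3 and M′ is
-- disconnected.  The search has a few hundred nodes and is carried out by evaluation.

open import Defs
open import Data.Bool using (Bool; true; T; _∨_; _∧_)
open import Data.Bool.Properties using (T-∨; T-∧; T-≡) renaming (_≟_ to _≟ᵇ_)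
open import Data.Empty using (⊥)
open import Data.Fin using (Fin; zero; suc; _≟_; _<?_)
open import Data.Fin.Properties using (any?)
open import Data.Fin.Subset using (Subset; inside; outside; Nonempty; ⁅_⁆; _∈_; _∉_; _⊆_; _⊂_; _∪_; _∩_; _─_; _-_; ∁; ⋃; ∣_∣)
open import Data.Fin.Subset.Properties using (_∈?_; _⊆?_; nonempty?; ∣⁅x⁆∣≡1; x∈⁅x⁆; x∈⁅y⁆⇒x≡y; x≢y⇒x∉⁅y⁆; ⊆-antisym; p⊆q⇒∣p∣≤∣q∣; p⊂q⇒∣p∣<∣q∣; p∩q⊆p; p∩q⊆q; x∈p∩q⁺; p⊆p∪q; q⊆p∪q; x∈p∪q⁻; p─q⊆p; x∈p∧x∉q⇒x∈p─q; x∈p∧x≢y⇒x∈p-y; x∈p⇒p-x⊂p; x∈p⇒∣p-x∣<∣p∣; Empty-unique; ∣⊥∣≡0)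
open import Data.Fin.Subset.Induction using (⊂-wellFounded; Acc; acc)
open import Data.List using (List; []; _∷_; _++_; map; filter; foldl; allFin; cartesianProduct)
open import Data.List.Membership.Propositional using () renaming (_∈_ to _∈ₗ_)
open import Data.List.Membership.Propositional.Properties using (∈-filter⁺; ∈-++⁺ˡ; ∈-++⁺ʳ; ∈-map⁺)
open import Data.List.Relation.Unary.All using (All; []; _∷_; all?; lookup)
open import Data.List.Relation.Unary.Any using (here; there)
import Data.List.Membership.DecPropositional as DecMembership
open import Data.Nat using (ℕ; suc; _+_; _≤_; _<_; z≤n; s≤s; _≤?_)
import Data.Nat as ℕ
open import Data.Nat.Properties using (≤-trans; ≤-reflexive; +-suc; +-comm; m≤n⇒m≤1+n; <-irrefl; ≤⇒≯; <⇒≱)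
open import Data.Product using (_×_; ∃; ∃-syntax; _,_; proj₁)
open import Data.Sum using (inj₁; inj₂)
import Data.Vec as Vec
open Vec using ([]; _∷_)
open import Data.Vec.Properties using (≡-dec)
open import Function using (_∘_)
open import Function.Bundles using (Equivalence)
open import Relation.Binary.PropositionalEquality using (_≡_; _≢_; refl; sym; trans; cong; subst)
open import Relation.Nullary using (¬_; Dec; yes; no; contradiction)
open import Relation.Nullary.Decidable using (¬?; _×-dec_; _→-dec_; ⌊_⌋; toWitness)

-- Differences and cardinalities of finite subsets.

x∈p─q⇒x∉q : ∀ {n} (p q : Subset n) {x} → x ∈ p ─ q → x ∉ q
x∈p─q⇒x∉q (_ ∷ p) (inside ∷ q) (Vec.there x∈) (Vec.there x∈q) = x∈p─q⇒x∉q p q x∈ x∈q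
x∈p─q⇒x∉q (_ ∷ p) (outside ∷ q) (Vec.there x∈) (Vec.there x∈q) = x∈p─q⇒x∉q p q x∈ x∈q

x∈p-y⇒x≢y : ∀ {n} (p : Subset n) {x y} → x ∈ p - y → x ≢ y
x∈p-y⇒x≢y p {x} x∈ refl = x∈p─q⇒x∉q p ⁅ x ⁆ x∈ (x∈⁅x⁆ x)

∣p∪q∣≤∣p∣+∣q∣ : ∀ {n} (p q : Subset n) → ∣ p ∪ q ∣ ≤ ∣ p ∣ + ∣ q ∣
∣p∪q∣≤∣p∣+∣q∣ [] [] = z≤n
∣p∪q∣≤∣p∣+∣q∣ (outside ∷ p) (outside ∷ q) = ∣p∪q∣≤∣p∣+∣q∣ p q
∣p∪q∣≤∣p∣+∣q∣ (outside ∷ p) (inside ∷ q) rewrite +-suc ∣ p ∣ ∣ q ∣ = s≤s (∣p∪q∣≤∣p∣+∣q∣ p q)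
∣p∪q∣≤∣p∣+∣q∣ (inside ∷ p) (outside ∷ q) = s≤s (∣p∪q∣≤∣p∣+∣q∣ p q)
∣p∪q∣≤∣p∣+∣q∣ (inside ∷ p) (inside ∷ q) rewrite +-suc ∣ p ∣ ∣ q ∣ = s≤s (m≤n⇒m≤1+n (∣p∪q∣≤∣p∣+∣q∣ p q))

p─q-empty⇒p⊆q : ∀ {n} {p q : Subset n} → ¬ Nonempty (p ─ q) → p ⊆ q
p─q-empty⇒p⊆q {q = q} empty {x} x∈p with x ∈? q
... | yes x∈q = x∈q
... | no  x∉q = contradiction (x , x∈p∧x∉q⇒x∈p─q x∈p x∉q) empty

∣q∣<∣p∣⇒p─q-nonempty : ∀ {n} {p q : Subset n} → ∣ q ∣ < ∣ p ∣ → Nonempty (p ─ q)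
∣q∣<∣p∣⇒p─q-nonempty {p = p} {q} q<p with nonempty? (p ─ q)
... | yes nonempty = nonempty
... | no  empty    = contradiction (p⊆q⇒∣p∣≤∣q∣ (p─q-empty⇒p⊆q empty)) (<⇒≱ q<p)

p⊆q∧∣q∣≤∣p∣⇒p≡q : ∀ {n} {p q : Subset n} → p ⊆ q → ∣ q ∣ ≤ ∣ p ∣ → p ≡ q
p⊆q∧∣q∣≤∣p∣⇒p≡q {p = p} {q} p⊆q q≤p with nonempty? (q ─ p)
... | yes (x , x∈) = contradiction (p⊂q⇒∣p∣<∣q∣ (p⊆q , x , p─q⊆p q p x∈ , x∈p─q⇒x∉q q p x∈)) (≤⇒≯ q≤p)
... | no  empty    = ⊆-antisym p⊆q (p─q-empty⇒p⊆q empty)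

∣p∣≡1⇒nonempty : ∀ {n} {p : Subset n} → ∣ p ∣ ≡ 1 → Nonempty p
∣p∣≡1⇒nonempty {n} {p} p≡1 with nonempty? p
... | yes nonempty = nonempty
... | no  empty    = contradiction (trans (sym p≡1) (trans (cong ∣_∣ (Empty-unique empty)) (∣⊥∣≡0 n))) λ ()

∣p∣≡1⇒unique : ∀ {n} {p : Subset n} → ∣ p ∣ ≡ 1 → ∀ {x y} → x ∈ p → y ∈ p → x ≡ y
∣p∣≡1⇒unique {p = p} p≡1 {x} {y} x∈p y∈p with x ≟ y
... | yes x≡y = x≡y
... | no  x≢y = contradiction (≤-trans (s≤s (≤-trans (s≤s z≤n) (x∈p⇒∣p-x∣<∣p∣ (x∈p∧x≢y⇒x∈p-y y∈p (x≢y ∘ sym))))) (x∈p⇒∣p-x∣<∣p∣ x∈p))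
                              λ lt → <-irrefl refl (≤-trans lt (≤-reflexive p≡1))

∈⇒⊆⋃ : ∀ {n} {p : Subset n} {ps} → p ∈ₗ ps → p ⊆ ⋃ ps
∈⇒⊆⋃ {ps = q ∷ ps} (here refl) = p⊆p∪q (⋃ ps)
∈⇒⊆⋃ {ps = q ∷ ps} (there p∈)  = q⊆p∪q q (⋃ ps) ∘ ∈⇒⊆⋃ p∈

-- Enumerating subsets; single exchanges and pairs of elements.

subsets : ∀ n → List (Subset n)
subsets ℕ.zero = [] ∷ []
subsets (suc n) = map (outside ∷_) (subsets n) ++ map (inside ∷_) (subsets n)

∈-subsets : ∀ {n} (p : Subset n) → p ∈ₗ subsets n
∈-subsets [] = here refl
∈-subsets (outside ∷ p) = ∈-++⁺ˡ (∈-map⁺ (outside ∷_) (∈-subsets p))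
∈-subsets (inside  ∷ p) = ∈-++⁺ʳ _ (∈-map⁺ (inside ∷_) (∈-subsets p))

swap : ∀ {n} → Fin n → Fin n → Subset n → Subset n
swap q p B = (B - q) ∪ ⁅ p ⁆

pair : ∀ {n} → Fin n × Fin n → Subset n
pair (p , q) = ⁅ p ⁆ ∪ ⁅ q ⁆

⊆-swap : ∀ {n} {X B : Subset n} {x} y → X ⊆ B → x ∉ X → X ⊆ swap x y B
⊆-swap {B = B} {x} y X⊆B x∉X {z} z∈X =
  p⊆p∪q ⁅ y ⁆ (x∈p∧x≢y⇒x∈p-y (X⊆B z∈X) λ { refl → x∉X z∈X })

y∈swap : ∀ {n} x y (B : Subset n) → y ∈ swap x y B
y∈swap x y B = q⊆p∪q (B - x) ⁅ y ⁆ (x∈⁅x⁆ y)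

pair⊆ : ∀ {n} {p q : Fin n} {B : Subset n} → p ∈ B → q ∈ B → pair (p , q) ⊆ B
pair⊆ {_} {p} {q} {B} p∈B q∈B x∈ with x∈p∪q⁻ ⁅ p ⁆ ⁅ q ⁆ x∈
... | inj₁ x∈p = subst (_∈ B) (sym (x∈⁅y⁆⇒x≡y p x∈p)) p∈B
... | inj₂ x∈q = subst (_∈ B) (sym (x∈⁅y⁆⇒x≡y q x∈q)) q∈B

∣pair∣<3 : ∀ {n} (X : Fin n × Fin n) → ∣ pair X ∣ < 3
∣pair∣<3 (p , q) = s≤s (≤-trans (∣p∪q∣≤∣p∣+∣q∣ ⁅ p ⁆ ⁅ q ⁆)
  (≤-reflexive (trans (cong (_+ ∣ ⁅ q ⁆ ∣) (∣⁅x⁆∣≡1 p)) (cong (1 +_) (∣⁅x⁆∣≡1 q)))))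

pairs : ∀ n → List (Fin n × Fin n)
pairs n = filter (λ (p , q) → p <? q) (cartesianProduct (allFin n) (allFin n))

-- Pruning rules and the case search.

-- A list of candidates over-approximates the family of bases of an unknown matroid.
module Search {n : ℕ} (targets : List (Subset n)) where

  private
    _≟ˢ_ : (A B : Subset n) → Dec (A ≡ B)
    _≟ˢ_ = ≡-dec _≟ᵇ_

  open DecMembership _≟ˢ_ using () renaming (_∈?_ to _∈ₗ?_)

  Candidates : Set
  Candidates = List (Subset n)

  -- If `C` contains all bases and `X` is independent, this contains every element outside the
  -- closure of `X`.
  extensions : Candidates → Subset n → Subset n
  extensions C X = ⋃ (filter (X ⊆?_) C) ─ X

  meeting : Subset n → Candidates → Candidates
  meeting S = filter (λ B → nonempty? (B ∩ S))

  spanning : Candidates → Fin n × Fin n → Candidates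
  spanning C X = meeting (extensions C (pair X)) C

  -- Replacing `q` by a parallel `p` turns bases into bases, so a candidate whose image is not a
  -- candidate cannot be a base.
  swappable : Fin n → Fin n → Candidates → Candidates
  swappable p q C = filter (λ B → (q ∈? B) →-dec (swap q p B ∈ₗ? C)) C

  merging : Candidates → Fin n × Fin n → Candidates
  merging C (p , q) = swappable q p (swappable p q C)

  avoiding : Subset n → Candidates → Candidates
  avoiding X = filter (λ B → ¬? (X ⊆? B))

  removing : Subset n → Candidates → Candidates
  removing X = filter (λ B → ¬? (B ≟ˢ X))

  -- A single pass, not a fixpoint: later removals can shrink extensions computed earlier, which is
  -- why the leaves of the search run it twice.
  saturate : (parallel independent : List (Fin n × Fin n)) → Candidates → Candidates
  saturate P I C = foldl spanning (foldl merging C P) I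

  Separates : Candidates → Subset n → Set
  Separates C S = All (λ B → ∣ B ∩ S ∣ ≡ 1) C

  separates? : ∀ C S → Dec (Separates C S)
  separates? C S = all? (λ B → ∣ B ∩ S ∣ ℕ.≟ 1) C

  -- The complement of the extensions of ⁅ p ⁆ is the parallel class of p, as far as C determines it.
  separable? : ∀ C → Dec (∃ λ p → Separates C (∁ (extensions C ⁅ p ⁆)))
  separable? C = any? (λ p → separates? C (∁ (extensions C ⁅ p ⁆)))

  -- Once no pair is undecided, some member of targets is known to be a nonbase, but not which one;
  -- hence every choice has to be refuted.
  refutes : (undecided parallel independent : List (Fin n × Fin n)) → Candidates → Bool
  refutes [] P I C =
    ⌊ separable? C ⌋ ∨ ⌊ all? (λ B → separable? (saturate P I (saturate P I (removing B C)))) targets ⌋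
  refutes (X ∷ Xs) P I C =
    ⌊ separable? C ⌋ ∨ (refutes Xs (X ∷ P) I (saturate (X ∷ P) I (avoiding (pair X) C))
                      ∧ refutes Xs P (X ∷ I) (saturate P (X ∷ I) C))

-- Parallel elements and separators in a connected matroid of rank 3.

module Soundness {n : ℕ} (ℬ : Family n) (isMatroid : IsMatroid ℬ) (connected : Connected ℬ)
                 (rank-3 : ∀ {B} → T (ℬ B) → ∣ B ∣ ≡ 3)
                 (other : ∀ (x : Fin n) → ∃ λ y → x ≢ y) where

  open IsMatroid isMatroid

  -- A circuit through `p` and a second element properly contains `⁅ p ⁆`, so its minimality makes
  -- `⁅ p ⁆` independent.
  nonloop : ∀ p → ∃[ B ] (T (ℬ B) × p ∈ B)
  nonloop p with other p
  ... | q , p≢q with connected p q p≢q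
  ... | C , (_ , minimal) , p∈C , q∈C with minimal ⁅ p ⁆ (p⊆C , q , q∈C , x≢y⇒x∉⁅y⁆ (p≢q ∘ sym))
    where
    p⊆C : ⁅ p ⁆ ⊆ C
    p⊆C x∈ = subst (_∈ C) (sym (x∈⁅y⁆⇒x≡y p x∈)) p∈C
  ... | B , baseB , p⊆B = B , baseB , p⊆B (x∈⁅x⁆ p)

  ∣swap∣≤3 : ∀ {p q B} → T (ℬ B) → q ∈ B → ∣ swap q p B ∣ ≤ 3
  ∣swap∣≤3 {p} {q} {B} baseB q∈B = ≤-trans (∣p∪q∣≤∣p∣+∣q∣ (B - q) ⁅ p ⁆)
    (≤-trans (≤-reflexive (trans (cong (∣ B - q ∣ +_) (∣⁅x⁆∣≡1 p)) (+-comm ∣ B - q ∣ 1)))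
      (≤-trans (x∈p⇒∣p-x∣<∣p∣ q∈B) (≤-reflexive (rank-3 baseB))))

  Parallel : Fin n → Fin n → Set
  Parallel p q = ¬ Independent ℬ (pair (p , q))

  -- Any base through p is exchanged step by step into swap q p B; parallelism keeps q from being brought in.
  parallel-swap : ∀ {p q} → Parallel p q → ∀ {B} → T (ℬ B) → q ∈ B → T (ℬ (swap q p B))
  parallel-swap {p} {q} p∥q {B} baseB q∈B with nonloop p
  ... | B₀ , baseB₀ , p∈B₀ = approach B₀ baseB₀ p∈B₀ (⊂-wellFounded _)
    where
    approach : ∀ B′ → T (ℬ B′) → p ∈ B′ → Acc _⊂_ (B′ ─ swap q p B) → T (ℬ (swap q p B))
    approach B′ baseB′ p∈B′ (acc smaller) with nonempty? (B′ ─ swap q p B)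
    ... | no  empty = subst (T ∘ ℬ)
          (p⊆q∧∣q∣≤∣p∣⇒p≡q (p─q-empty⇒p⊆q empty)
            (≤-trans (∣swap∣≤3 baseB q∈B) (≤-reflexive (sym (rank-3 baseB′))))) baseB′
    ... | yes (x , x∈) with base-exchange B′ B baseB′ baseB x (p─q⊆p B′ (swap q p B) x∈) x∉B
      where
      x∈B′ : x ∈ B′
      x∈B′ = p─q⊆p B′ (swap q p B) x∈
      x≢q : x ≢ q
      x≢q refl = p∥q (B′ , baseB′ , pair⊆ p∈B′ x∈B′)
      x∉B : x ∉ B
      x∉B x∈B = x∈p─q⇒x∉q B′ (swap q p B) x∈ (p⊆p∪q ⁅ p ⁆ (x∈p∧x≢y⇒x∈p-y x∈B x≢q))
    -- `y` lies in `B` and differs from `q`, hence lies in the target: the difference loses `x` and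
    -- gains nothing.
    ... | y , y∈B , y∉B′ , baseB″ = approach B″ baseB″ p∈B″ (smaller (shrinks , x , x∈ , x∉B″ ∘ p─q⊆p B″ A))
      where
      A B″ : Subset n
      A = swap q p B
      B″ = swap x y B′
      p≢x : p ≢ x
      p≢x refl = x∈p─q⇒x∉q B′ A x∈ (y∈swap q p B)
      p∈B″ : p ∈ B″
      p∈B″ = p⊆p∪q ⁅ y ⁆ (x∈p∧x≢y⇒x∈p-y p∈B′ p≢x)
      y≢q : y ≢ q
      y≢q refl = p∥q (B″ , baseB″ , pair⊆ p∈B″ (y∈swap x y B′))
      x∉B″ : x ∉ B″
      x∉B″ x∈B″ with x∈p∪q⁻ (B′ - x) ⁅ y ⁆ x∈B″
      ... | inj₁ x∈- = x∈p-y⇒x≢y B′ x∈- refl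
      ... | inj₂ x∈y = y∉B′ (subst (_∈ B′) (x∈⁅y⁆⇒x≡y y x∈y) (p─q⊆p B′ A x∈))
      shrinks : B″ ─ A ⊆ B′ ─ A
      shrinks z∈ with x∈p∪q⁻ (B′ - x) ⁅ y ⁆ (p─q⊆p B″ A z∈)
      ... | inj₁ z∈- = x∈p∧x∉q⇒x∈p─q (p─q⊆p B′ ⁅ x ⁆ z∈-) (x∈p─q⇒x∉q B″ A z∈)
      ... | inj₂ z∈y with refl ← x∈⁅y⁆⇒x≡y y z∈y =
        contradiction (p⊆p∪q ⁅ p ⁆ (x∈p∧x≢y⇒x∈p-y y∈B y≢q)) (x∈p─q⇒x∉q B″ A z∈)

  -- A circuit C through x ∈ S and y ∉ S would meet S in x alone.  Then C - x lies in a base, and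
  -- exchanging the element of S in that base for x gives a base containing C.
  no-separator : ∀ S → ¬ (∀ {B} → T (ℬ B) → ∣ B ∩ S ∣ ≡ 1)
  no-separator S one with base-nonempty
  -- A base has 3 elements and only one in `S`, so it supplies both an `x` in `S` and a `y` outside.
  ... | B₀ , baseB₀ with ∣q∣<∣p∣⇒p─q-nonempty {p = B₀} {B₀ ∩ S} lt
                       | ∣p∣≡1⇒nonempty (one baseB₀)
    where
    lt : ∣ B₀ ∩ S ∣ < ∣ B₀ ∣
    lt rewrite one baseB₀ | rank-3 baseB₀ = s≤s (s≤s z≤n)
  ... | y , y∈ | x , x∈ = circuit-absurd (connected x y x≢y)
    where
    y∉S : y ∉ S
    y∉S y∈S = x∈p─q⇒x∉q B₀ (B₀ ∩ S) y∈ (x∈p∩q⁺ (p─q⊆p B₀ (B₀ ∩ S) y∈ , y∈S))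
    x∈S : x ∈ S
    x∈S = p∩q⊆q B₀ S x∈
    x≢y : x ≢ y
    x≢y refl = y∉S x∈S
    unique : ∀ {B} → T (ℬ B) → ∀ {u v} → u ∈ B → u ∈ S → v ∈ B → v ∈ S → u ≡ v
    unique baseB u∈B u∈S v∈B v∈S = ∣p∣≡1⇒unique (one baseB) (x∈p∩q⁺ (u∈B , u∈S)) (x∈p∩q⁺ (v∈B , v∈S))
    circuit-absurd : ∃[ C ] (Circuit ℬ C × x ∈ C × y ∈ C) → ⊥
    circuit-absurd (C , (dependent , minimal) , x∈C , y∈C)
      with minimal (C - x) (x∈p⇒p-x⊂p x∈C) | minimal (C - y) (x∈p⇒p-x⊂p y∈C)
    ... | B₁ , baseB₁ , C-x⊆B₁ | B₂ , baseB₂ , C-y⊆B₂ = absurd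
      where
      -- `C - y` lies in the base `B₂`, which meets `S` only once.
      C∩S⊆x : ∀ {z} → z ∈ C → z ∈ S → z ≡ x
      C∩S⊆x z∈C z∈S = unique baseB₂ (C-y⊆B₂ (x∈p∧x≢y⇒x∈p-y z∈C λ { refl → y∉S z∈S })) z∈S
                             (C-y⊆B₂ (x∈p∧x≢y⇒x∈p-y x∈C x≢y)) x∈S
      x∈B₂ : x ∈ B₂
      x∈B₂ = C-y⊆B₂ (x∈p∧x≢y⇒x∈p-y x∈C x≢y)
      absurd : ⊥
      absurd with ∣p∣≡1⇒nonempty (one baseB₁)
      ... | s , s∈ with p∩q⊆p B₁ S s∈ | p∩q⊆q B₁ S s∈
      ... | s∈B₁ | s∈S with s ≟ x
      ... | yes refl = dependent (B₁ , baseB₁ , C⊆B₁)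
        where
        C⊆B₁ : C ⊆ B₁
        C⊆B₁ {z} z∈C with z ≟ x
        ... | yes refl = s∈B₁
        ... | no  z≢x  = C-x⊆B₁ (x∈p∧x≢y⇒x∈p-y z∈C z≢x)
      ... | no s≢x with base-exchange B₁ B₂ baseB₁ baseB₂ s s∈B₁ (λ s∈B₂ → s≢x (unique baseB₂ s∈B₂ s∈S x∈B₂ x∈S))
      ... | t , t∈B₂ , _ , baseB = dependent (B , baseB , C⊆B)
        where
        B : Subset n
        B = swap s t B₁
        -- Removing `s` takes `B₁` out of `S`, and the new base must meet `S`, so `t` does; as `B₂`
        -- meets `S` only in `x`, this forces `t ≡ x`.
        t∈S : t ∈ S
        t∈S with ∣p∣≡1⇒nonempty (one baseB)
        ... | u , u∈B∩S with x∈p∪q⁻ (B₁ - s) ⁅ t ⁆ (p∩q⊆p B S u∈B∩S) | p∩q⊆q B S u∈B∩S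
        ... | inj₁ u∈- | u∈S =
          contradiction (unique baseB₁ (p─q⊆p B₁ ⁅ s ⁆ u∈-) u∈S s∈B₁ s∈S) (x∈p-y⇒x≢y B₁ u∈-)
        ... | inj₂ u∈t | u∈S = subst (_∈ S) (x∈⁅y⁆⇒x≡y t u∈t) u∈S
        C⊆B : C ⊆ B
        C⊆B {z} z∈C with z ≟ x
        ... | yes refl = subst (_∈ B) (unique baseB₂ t∈B₂ t∈S x∈B₂ x∈S) (y∈swap s t B₁)
        ... | no  z≢x  = p⊆p∪q ⁅ t ⁆ (x∈p∧x≢y⇒x∈p-y (C-x⊆B₁ (x∈p∧x≢y⇒x∈p-y z∈C z≢x))
                           λ { refl → z≢x (C∩S⊆x z∈C s∈S) })

  -- Soundness of the pruning rules and of the search.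

  module _ (targets : List (Subset n)) where

    open Search targets

    Covers : Candidates → Set
    Covers C = ∀ {B} → T (ℬ B) → B ∈ₗ C

    -- The closure of a pair has rank at most 2, so no base lies inside it.
    spanning-covers : ∀ {C} X → Independent ℬ (pair X) → Covers C → Covers (spanning C X)
    spanning-covers {C} X (B₀ , baseB₀ , X⊆B₀) covers {B} baseB =
      ∈-filter⁺ (λ B → nonempty? (B ∩ extensions C (pair X))) (covers baseB) meets
      where
      extends : ∀ {B y} → T (ℬ B) → pair X ⊆ B → y ∈ B → y ∉ pair X → y ∈ extensions C (pair X)
      extends baseB X⊆B y∈B y∉X =
        x∈p∧x∉q⇒x∈p─q (∈⇒⊆⋃ (∈-filter⁺ (pair X ⊆?_) (covers baseB) X⊆B) y∈B) y∉X
      meets : Nonempty (B ∩ extensions C (pair X))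
      meets with ∣q∣<∣p∣⇒p─q-nonempty {p = B₀} {pair X} (subst (∣ pair X ∣ <_) (sym (rank-3 baseB₀)) (∣pair∣<3 X))
      ... | z , z∈ with p─q⊆p B₀ (pair X) z∈ | x∈p─q⇒x∉q B₀ (pair X) z∈ | z ∈? B
      ... | z∈B₀ | z∉X | yes z∈B = z , x∈p∩q⁺ (z∈B , extends baseB₀ X⊆B₀ z∈B₀ z∉X)
      -- Exchanging `z`, which is outside the pair, leaves the pair inside the new base, so the
      -- incoming `y` of `B` is an extension.
      ... | z∈B₀ | z∉X | no  z∉B with base-exchange B₀ B baseB₀ baseB z z∈B₀ z∉B
      ... | y , y∈B , y∉B₀ , baseB′ =
        y , x∈p∩q⁺ (y∈B , extends baseB′ (⊆-swap y X⊆B₀ z∉X) (y∈swap z y B₀) (y∉B₀ ∘ X⊆B₀))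

    swappable-covers : ∀ {C p q} → Parallel p q → Covers C → Covers (swappable p q C)
    swappable-covers p∥q covers baseB =
      ∈-filter⁺ _ (covers baseB) λ q∈B → covers (parallel-swap p∥q baseB q∈B)

    merging-covers : ∀ {C} X → ¬ Independent ℬ (pair X) → Covers C → Covers (merging C X)
    merging-covers (p , q) p∥q covers = swappable-covers q∥p (swappable-covers p∥q covers)
      where
      q∥p : Parallel q p
      q∥p (B , baseB , qp⊆B) = p∥q (B , baseB , pair⊆ (qp⊆B (q⊆p∪q ⁅ q ⁆ ⁅ p ⁆ (x∈⁅x⁆ p)))
                                                       (qp⊆B (p⊆p∪q ⁅ p ⁆ (x∈⁅x⁆ q))))

    foldl-covers : ∀ {A : Set} {Q : A → Set} (step : Candidates → A → Candidates) →
                   (∀ {C} x → Q x → Covers C → Covers (step C x)) →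
                   ∀ {C xs} → All Q xs → Covers C → Covers (foldl step C xs)
    foldl-covers step step-covers []         covers = covers
    foldl-covers step step-covers (qx ∷ qxs) covers =
      foldl-covers step step-covers qxs (step-covers _ qx covers)

    Dependents Independents : List (Fin n × Fin n) → Set
    Dependents   = All (λ X → ¬ Independent ℬ (pair X))
    Independents = All (λ X → Independent ℬ (pair X))

    saturate-covers : ∀ {P I C} → Dependents P → Independents I → Covers C → Covers (saturate P I C)
    saturate-covers dep ind covers =
      foldl-covers spanning spanning-covers ind (foldl-covers merging merging-covers dep covers)

    avoiding-covers : ∀ {C} X → ¬ Independent ℬ X → Covers C → Covers (avoiding X C)
    avoiding-covers X dep covers {B} baseB = ∈-filter⁺ (λ B → ¬? (X ⊆? B)) (covers baseB) λ X⊆B → dep (B , baseB , X⊆B)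

    removing-covers : ∀ {C} X → ¬ T (ℬ X) → Covers C → Covers (removing X C)
    removing-covers X nonbase covers baseB = ∈-filter⁺ _ (covers baseB) λ { refl → nonbase baseB }

    not-separable : ∀ {C} → Covers C → ¬ (∃ λ p → Separates C (∁ (extensions C ⁅ p ⁆)))
    not-separable covers (p , separates) = no-separator _ λ baseB → lookup separates (covers baseB)

    refutes-sound : ∀ {B} → B ∈ₗ targets → ¬ T (ℬ B) →
                    ∀ Xs {P I C} → T (refutes Xs P I C) → Dependents P → Independents I → ¬ Covers C
    refutes-sound {B} B∈ nonbase [] {P} {I} {C} refuted dep ind covers
      with Equivalence.to (T-∨ {⌊ separable? C ⌋}) refuted
    ... | inj₁ sep = not-separable covers (toWitness sep)
    ... | inj₂ all = not-separable
      (saturate-covers dep ind (saturate-covers dep ind (removing-covers B nonbase covers)))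
      (lookup (toWitness all) B∈)
    refutes-sound B∈ nonbase (X ∷ Xs) {P} {I} {C} refuted dep ind covers
      with Equivalence.to (T-∨ {⌊ separable? C ⌋}) refuted
    ... | inj₁ sep = not-separable covers (toWitness sep)
    ... | inj₂ both with Equivalence.to T-∧ both
    -- Independence of `X` is not decided: the goal is a negation, so refuting both cases suffices.
    ... | ifDependent , ifIndependent = dependent λ independent →
      refutes-sound B∈ nonbase Xs ifIndependent dep (independent ∷ ind)
        (saturate-covers dep (independent ∷ ind) covers)
      where
      dependent : ¬ ¬ Independent ℬ (pair X)
      dependent X-dep = refutes-sound B∈ nonbase Xs ifDependent (X-dep ∷ dep) ind
        (saturate-covers (X-dep ∷ dep) ind (avoiding-covers (pair X) X-dep covers))

    search-sound : Search.refutes targets (pairs n) [] [] targets ≡ true → Covers targets →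
                   ∀ {B} → B ∈ₗ targets → ¬ ¬ T (ℬ B)
    search-sound succeeds covers B∈ nonbase =
      refutes-sound B∈ nonbase (pairs n) (Equivalence.from T-≡ succeeds) [] [] covers

-- Evaluating the search on the bases of the given matroid.

isBaseM? : ∀ B → Dec (IsBaseM B)
isBaseM? B = (∣ B ∣ ℕ.≟ 3) ×-dec all? (λ F → ∣ B ∩ F ∣ ≤? 2) lines

basesM : List (Subset 8)
basesM = filter isBaseM? (subsets 8)

-- The qualified name keeps this type syntactically equal to the one search-sound expects;
-- otherwise its use below runs the search again.
search-succeeds : Search.refutes basesM (pairs 8) [] [] basesM ≡ true
search-succeeds = refl

other : ∀ {n} (x : Fin (suc (suc n))) → ∃ λ y → x ≢ y
other zero    = suc zero , λ ()
other (suc _) = zero , λ ()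

theorem5p5 : ¬ (∃[ ℬ' ] (IsMatroid ℬ' × Connected ℬ'
    × (∀ (B : Subset 8) → T (ℬ' B) → IsBaseM B)
    × ∃[ B ] (IsBaseM B × ¬ T (ℬ' B))))
theorem5p5 (ℬ , isMatroid , connected , ℬ⊆M , B , baseB , nonbaseB) =
  search-sound basesM search-succeeds (∈-basesM ∘ ℬ⊆M _) (∈-basesM baseB) nonbaseB
  where
  open Soundness ℬ isMatroid connected (λ baseB → proj₁ (ℬ⊆M _ baseB)) other
  ∈-basesM : ∀ {B} → IsBaseM B → B ∈ₗ basesM
  ∈-basesM {B} = ∈-filter⁺ isBaseM? (∈-subsets B)
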